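{- Let $G=(V,E)$ be a directed graph, and suppose $S,T\subseteq V$ are such that $\rho_G(S,T)=\rho^\star(G)$. Then \[\rho^\star(G)\ \geq\ \max\left(\sqrt{\frac{|S|}{|T|}},\ \sqrt{\frac{|T|}{|S|}}\right).\]
   Context: For an unweighted directed graph $G=(V,E)$ and nonempty $S,T\subseteq V$ (not necessarily disjoint), let $E(S,T)$ be the set of edges directed from a vertex of $S$ to a vertex of $T$, and define the density $\rho_G(S,T)=\frac{|E(S,T)|}{\sqrt{|S||T|}}$. Let $\rho^\star(G)=\max_{S,T}\rho_G(S,T)$, the maximum over such $S,T$.
   Formalization: The graph is assumed to have at least one edge; in an edgeless graph the maximum density is 0 while the right-hand side is at least 1, so the claim as stated fails there. -}

module Defs where

open import Data.Fin.Base using (Fin)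
open import Data.Fin.Subset using (Subset; inside; outside; Nonempty; ∣_∣)
open import Data.Fin.Subset.Properties using (_∈?_; nonempty?; x∈p⇒∣p-x∣<∣p∣)
import Data.Integer.Base as ℤ
open import Data.List.Base
  using (List; []; _∷_; _++_; map; mapMaybe; filter; foldr; length; allFin; cartesianProduct)
open import Data.Maybe.Base using (Maybe; just; nothing)
open import Data.Nat.Base as ℕ using (ℕ; zero; suc)
import Data.Nat.Properties as ℕ
open import Data.Product.Base using (Σ; ∃; _×_; _,_)
open import Data.Rational.Base hiding (∣_∣)
open import Data.Rational.Properties
open import Data.Sum.Base using (_⊎_; inj₁; inj₂; [_,_]′)
open import Data.Vec.Base as Vec using ()
open import Level using (0ℓ)
open import Relation.Binary.Core using (Rel)
open import Relation.Binary.Definitions using (Decidable; tri<; tri≈; tri>)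
open import Relation.Binary.PropositionalEquality
open import Relation.Nullary using (¬_; yes; no; contradiction)
open import Relation.Nullary.Decidable using (_×-dec_)

mulʳ-< : ∀ {p q} u → 0ℚ < u → p < q → p * u < q * u
mulʳ-< u 0<u = *-monoˡ-<-pos u {{positive 0<u}}

mulʳ-≤ : ∀ {p q} u → 0ℚ ≤ u → p ≤ q → p * u ≤ q * u
mulʳ-≤ u 0≤u = *-monoʳ-≤-nonNeg u {{nonNegative 0≤u}}

mulˡ-≤ : ∀ {p q} u → 0ℚ ≤ u → p ≤ q → u * p ≤ u * q
mulˡ-≤ u 0≤u = *-monoˡ-≤-nonNeg u {{nonNegative 0≤u}}

cancelʳ-< : ∀ {p q} u → 0ℚ < u → p * u < q * u → p < q
cancelʳ-< u 0<u = *-cancelʳ-<-nonNeg u {{nonNegative (<⇒≤ 0<u)}}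

quotient : ∀ c u → 0ℚ < u → ∃ λ q → q * u ≡ c
quotient c u 0<u = c * 1/ u , trans (*-assoc c (1/ u) u)
    (trans (cong (c *_) (*-inverseˡ u)) (*-identityʳ c))
  where instance _ = pos⇒nonZero u {{positive 0<u}}

0<a*b : ∀ {a b} → 0ℚ < a → 0ℚ < b → 0ℚ < a * b
0<a*b {a} {b} 0<a 0<b = subst (_< a * b) (*-zeroˡ b) (mulʳ-< b 0<b 0<a)

*-raise : ∀ {a u c} → 0ℚ < u → a * u < c → ∃ λ a′ → a < a′ × a′ * u < c
*-raise {a} {u} 0<u au<c with <-dense au<c
... | m , au<m , m<c with quotient m u 0<u
... | a′ , refl = a′ , cancelʳ-< u 0<u au<m , m<c

*-lower : ∀ {a u c} → 0ℚ < u → c < a * u → ∃ λ a′ → a′ < a × c < a′ * u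
*-lower {a} {u} 0<u c<au with <-dense c<au
... | m , c<m , m<au with quotient m u 0<u
... | a′ , refl = a′ , cancelʳ-< u 0<u m<au , c<m

sq-mono-< : ∀ {a b} → 0ℚ ≤ a → a < b → a * a < b * b
sq-mono-< {a} {b} 0≤a a<b =
  ≤-<-trans (mulˡ-≤ a 0≤a (<⇒≤ a<b)) (mulʳ-< b (≤-<-trans 0≤a a<b) a<b)

sq-raise : ∀ {r q} → 0ℚ ≤ r → r * r < q → ∃ λ r′ → r < r′ × r′ * r′ < q
sq-raise {r} {q} 0≤r rr<q =
  let s , r<s , rs<q = step
      0<s = ≤-<-trans 0≤r r<s
      t , r<t , ts<q = *-raise 0<s rs<q
      m , r<m , m<s⊓t = <-dense {r} {s ⊓ t} (r<⊓ r<s r<t)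
      0≤m = ≤-trans 0≤r (<⇒≤ r<m)
      m≤s = ≤-trans (<⇒≤ m<s⊓t) (p⊓q≤p s t)
      m≤t = ≤-trans (<⇒≤ m<s⊓t) (p⊓q≤q s t)
  in m , r<m , ≤-<-trans (mulˡ-≤ m 0≤m m≤s) (≤-<-trans (mulʳ-≤ s (<⇒≤ 0<s) m≤t) ts<q)
  where
  r<⊓ : ∀ {s t} → r < s → r < t → r < s ⊓ t
  r<⊓ {s} {t} r<s r<t with ⊓-sel s t
  ... | inj₁ e = subst (r <_) (sym e) r<s
  ... | inj₂ e = subst (r <_) (sym e) r<t

  step : ∃ λ s → r < s × r * s < q
  step with 0ℚ <? r
  ... | yes 0<r with *-raise {r} {r} 0<r rr<q
  ...   | s , r<s , sr<q = s , r<s , subst (_< q) (*-comm s r) sr<q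
  step | no 0≮r with ≤-antisym (≮⇒≥ 0≮r) 0≤r
  ...   | refl = 1ℚ , positive⁻¹ 1ℚ , subst (_< q) refl rr<q

⊔-< : ∀ {a b r} → a < r → b < r → a ⊔ b < r
⊔-< {a} {b} {r} a<r b<r with ⊔-sel a b
... | inj₁ e = subst (_< r) (sym e) a<r
... | inj₂ e = subst (_< r) (sym e) b<r

sq-lower : ∀ {r q} → 0ℚ < r → q < r * r → ∃ λ r′ → r′ < r × 0ℚ < r′ × q < r′ * r′
sq-lower {r} {q} 0<r q<rr with <-dense 0<r | *-lower {r} {r} 0<r q<rr
... | h , 0<h , h<r | t , t<r , q<tr = step (t ⊔ h) (⊔-< t<r h<r)
    (<-≤-trans 0<h (p≤q⊔p t h)) (<-≤-trans q<tr (mulʳ-≤ r (<⇒≤ 0<r) (p≤p⊔q t h)))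
  where
  step : ∀ s → s < r → 0ℚ < s → q < s * r → ∃ λ r′ → r′ < r × 0ℚ < r′ × q < r′ * r′
  step s s<r 0<s q<sr with *-lower {r} {s} 0<s (subst (q <_) (*-comm s r) q<sr)
  ... | t , t<r , q<ts = s ⊔ t , ⊔-< s<r t<r , 0<m , <-≤-trans q<ts
      (≤-trans (mulʳ-≤ s (<⇒≤ 0<s) (p≤q⊔p s t)) (mulˡ-≤ (s ⊔ t) (<⇒≤ 0<m) (p≤p⊔q s t)))
    where
    0<m : 0ℚ < s ⊔ t
    0<m = <-≤-trans 0<s (p≤p⊔q s t)

-- Real numbers as two-sided Dedekind cuts. That L is closed downwards and
-- U upwards follows from locatedness and disjointness (L-closed, U-closed).
record ℝ : Set₁ where
  field
    L U         : ℚ → Set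
    L-inhabited : ∃ L
    U-inhabited : ∃ U
    L-open      : ∀ {r} → L r → ∃ λ r′ → r < r′ × L r′
    U-open      : ∀ {r} → U r → ∃ λ r′ → r′ < r × U r′
    disjoint    : ∀ {r} → L r → ¬ U r
    located     : ∀ {a b} → a < b → L a ⊎ U b

open ℝ

L-closed : ∀ x {a b} → a ≤ b → L x b → L x a
L-closed x {a} {b} a≤b Lb with <-cmp a b
... | tri< a<b _ _  = [ (λ La → La) , (λ Ub → contradiction Ub (disjoint x Lb)) ]′ (located x a<b)
... | tri≈ _ refl _ = Lb
... | tri> _ _ b<a  = contradiction (<-≤-trans b<a a≤b) (<-irrefl refl)

U-closed : ∀ x {a b} → a ≤ b → U x a → U x b
U-closed x {a} {b} a≤b Ua with <-cmp a b
... | tri< a<b _ _  = [ (λ La → contradiction Ua (disjoint x La)) , (λ Ub → Ub) ]′ (located x a<b)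
... | tri≈ _ refl _ = Ua
... | tri> _ _ b<a  = contradiction (<-≤-trans b<a a≤b) (<-irrefl refl)

L<U : ∀ x {a b} → L x a → U x b → a < b
L<U x {a} {b} La Ub with a <? b
... | yes a<b = a<b
... | no  a≮b = contradiction (U-closed x (≮⇒≥ a≮b) Ub) (disjoint x La)

infix 4 _≤ᴿ_ _≥ᴿ_ _≃ᴿ_
infixl 6 _⊔ᴿ_

_≤ᴿ_ _≥ᴿ_ _≃ᴿ_ : ℝ → ℝ → Set
x ≤ᴿ y = ∀ {r} → L x r → L y r
x ≥ᴿ y = y ≤ᴿ x
x ≃ᴿ y = x ≤ᴿ y × y ≤ᴿ x

fromℚ : ℚ → ℝ
fromℚ q = record
  { L           = _< q
  ; U           = q <_
  ; L-inhabited = q - 1ℚ , subst (q - 1ℚ <_) (+-identityʳ q) (+-monoʳ-< q (negative⁻¹ (- 1ℚ)))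
  ; U-inhabited = q + 1ℚ , subst (_< q + 1ℚ) (+-identityʳ q) (+-monoʳ-< q (positive⁻¹ 1ℚ))
  ; L-open      = <-dense
  ; U-open      = λ q<r → let m , q<m , m<r = <-dense q<r in m , m<r , q<m
  ; disjoint    = <-asym
  ; located     = loc
  }
  where
  loc : ∀ {a b} → a < b → a < q ⊎ q < b
  loc {a} a<b with a <? q
  ... | yes a<q = inj₁ a<q
  ... | no  a≮q = inj₂ (≤-<-trans (≮⇒≥ a≮q) a<b)

0ᴿ : ℝ
0ᴿ = fromℚ 0ℚ

natℚ : ℕ → ℚ
natℚ n = ℤ.+ n / 1

fromℕ : ℕ → ℝ
fromℕ n = fromℚ (natℚ n)

0≤natℚ : ∀ n → 0ℚ ≤ natℚ n
0≤natℚ n = nonNegative⁻¹ (natℚ n) {{normalize-nonNeg n 1}}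

0<natℚ : ∀ n .{{_ : ℕ.NonZero n}} → 0ℚ < natℚ n
0<natℚ n = positive⁻¹ (natℚ n) {{normalize-pos n 1}}

_⊔ᴿ_ : ℝ → ℝ → ℝ
x ⊔ᴿ y = record
  { L           = λ r → L x r ⊎ L y r
  ; U           = λ r → U x r × U y r
  ; L-inhabited = let r , Lr = L-inhabited x in r , inj₁ Lr
  ; U-inhabited = let a , Ua = U-inhabited x
                      b , Ub = U-inhabited y
                  in a ⊔ b , U-closed x (p≤p⊔q a b) Ua , U-closed y (p≤q⊔p a b) Ub
  ; L-open      = λ where
      (inj₁ Lr) → let r′ , r<r′ , Lr′ = L-open x Lr in r′ , r<r′ , inj₁ Lr′
      (inj₂ Lr) → let r′ , r<r′ , Lr′ = L-open y Lr in r′ , r<r′ , inj₂ Lr′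
  ; U-open      = λ (Ux , Uy) →
      let a , a<r , Ua = U-open x Ux
          b , b<r , Ub = U-open y Uy
      in a ⊔ b , ⊔-< a<r b<r , U-closed x (p≤p⊔q a b) Ua , U-closed y (p≤q⊔p a b) Ub
  ; disjoint    = λ where
      (inj₁ Lr) (Ux , _) → disjoint x Lr Ux
      (inj₂ Lr) (_ , Uy) → disjoint y Lr Uy
  ; located     = loc
  }
  where
  loc : ∀ {a b} → a < b → (L x a ⊎ L y a) ⊎ (U x b × U y b)
  loc a<b with located x a<b | located y a<b
  ... | inj₁ La | _       = inj₁ (inj₁ La)
  ... | inj₂ _  | inj₁ La = inj₁ (inj₂ La)
  ... | inj₂ Ub | inj₂ Vb = inj₂ (Ub , Vb)

-- The nonnegative square root; it is 0 when the argument is not positive.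
√_ : ℝ → ℝ
√ x = record
  { L           = λ r → r < 0ℚ ⊎ L x (r * r)
  ; U           = λ r → 0ℚ < r × U x (r * r)
  ; L-inhabited = - 1ℚ , inj₁ (negative⁻¹ (- 1ℚ))
  ; U-inhabited = upper
  ; L-open      = L-open′
  ; U-open      = λ (0<r , Urr) →
      let q , q<rr , Uq         = U-open x Urr
          m , m<r , 0<m , q<mm = sq-lower 0<r q<rr
      in m , m<r , 0<m , U-closed x (<⇒≤ q<mm) Uq
  ; disjoint    = λ where
      (inj₁ r<0) (0<r , _) → <-asym r<0 0<r
      (inj₂ Lrr) (_ , Urr) → disjoint x Lrr Urr
  ; located     = loc
  }
  where
  upper : ∃ λ r → 0ℚ < r × U x (r * r)
  upper with U-inhabited x
  ... | u , Uu = u ⊔ 1ℚ , 0<v , U-closed x (≤-trans (p≤p⊔q u 1ℚ) (v≤vv (p≤q⊔p u 1ℚ))) Uu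
    where
    0<v : 0ℚ < u ⊔ 1ℚ
    0<v = <-≤-trans (positive⁻¹ 1ℚ) (p≤q⊔p u 1ℚ)

    v≤vv : ∀ {v} → 1ℚ ≤ v → v ≤ v * v
    v≤vv {v} 1≤v = subst (_≤ v * v) (*-identityʳ v)
      (mulˡ-≤ v (≤-trans (nonNegative⁻¹ 1ℚ) 1≤v) 1≤v)

  L-open′ : ∀ {r} → r < 0ℚ ⊎ L x (r * r) → ∃ λ r′ → r < r′ × (r′ < 0ℚ ⊎ L x (r′ * r′))
  L-open′ {r} Lr with r <? 0ℚ | Lr
  ... | yes r<0 | _        = let m , r<m , m<0 = <-dense r<0 in m , r<m , inj₁ m<0
  ... | no  r≮0 | inj₁ r<0 = contradiction r<0 r≮0
  ... | no  r≮0 | inj₂ Lrr =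
    let q , rr<q , Lq  = L-open x Lrr
        m , r<m , mm<q = sq-raise (≮⇒≥ r≮0) rr<q
    in m , r<m , inj₂ (L-closed x (<⇒≤ mm<q) Lq)

  loc : ∀ {a b} → a < b → (a < 0ℚ ⊎ L x (a * a)) ⊎ (0ℚ < b × U x (b * b))
  loc {a} a<b with a <? 0ℚ
  ... | yes a<0 = inj₁ (inj₁ a<0)
  ... | no  a≮0 with located x (sq-mono-< (≮⇒≥ a≮0) a<b)
  ...   | inj₁ Laa = inj₁ (inj₂ Laa)
  ...   | inj₂ Ubb = inj₂ (≤-<-trans (≮⇒≥ a≮0) a<b , Ubb)

Positiveᴿ : ℝ → Set
Positiveᴿ x = L x 0ℚ

√-positive : ∀ x → Positiveᴿ x → Positiveᴿ (√ x)
√-positive x 0<x = inj₂ 0<x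

-- The quotient p / y for p ≥ 0 and y > 0: a rational r is below it iff r u < p
-- for some u > y, and above it iff r l > p for some 0 < l < y.
divᴿ : (p : ℚ) → 0ℚ ≤ p → (y : ℝ) → Positiveᴿ y → ℝ
divᴿ p 0≤p y 0<y = record
  { L           = λ r → ∃ λ u → U y u × r * u < p
  ; U           = λ r → ∃ λ l → 0ℚ < l × L y l × p < r * l
  ; L-inhabited = - 1ℚ , negative-below (negative⁻¹ (- 1ℚ))
  ; U-inhabited = upper
  ; L-open      = λ (u , Uu , ru<p) →
      let r′ , r<r′ , r′u<p = *-raise (L<U y 0<y Uu) ru<p in r′ , r<r′ , u , Uu , r′u<p
  ; U-open      = λ (l , 0<l , Ll , p<rl) →
      let r′ , r′<r , p<r′l = *-lower 0<l p<rl in r′ , r′<r , l , 0<l , Ll , p<r′l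
  ; disjoint    = λ {r} → disj {r}
  ; located     = loc
  }
  where
  negative-below : ∀ {r} → r < 0ℚ → ∃ λ u → U y u × r * u < p
  negative-below {r} r<0 with U-inhabited y
  ... | u , Uu = u , Uu ,
    <-≤-trans (subst (r * u <_) (*-zeroˡ u) (mulʳ-< u (L<U y 0<y Uu) r<0)) 0≤p

  upper : ∃ λ r → ∃ λ l → 0ℚ < l × L y l × p < r * l
  upper with L-open y 0<y
  ... | l , 0<l , Ll with quotient (p + 1ℚ) l 0<l
  ...   | r , rl≡p+1 = r , l , 0<l , Ll ,
    subst₂ _<_ (+-identityʳ p) (sym rl≡p+1) (+-monoʳ-< p (positive⁻¹ 1ℚ))

  disj : ∀ {r} → (∃ λ u → U y u × r * u < p) → ¬ (∃ λ l → 0ℚ < l × L y l × p < r * l)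
  disj {r} (u , Uu , ru<p) (l , 0<l , Ll , p<rl) =
    <-irrefl refl (<-≤-trans (<-trans ru<p p<rl) (mulˡ-≤ r (<⇒≤ 0<r) (<⇒≤ (L<U y Ll Uu))))
    where
    0<r : 0ℚ < r
    0<r = cancelʳ-< l 0<l (subst (_< r * l) (sym (*-zeroˡ l)) (≤-<-trans 0≤p p<rl))

  loc : ∀ {a b} → a < b →
        (∃ λ u → U y u × a * u < p) ⊎ (∃ λ l → 0ℚ < l × L y l × p < b * l)
  loc {a} {b} a<b with a <? 0ℚ | 0ℚ <? p
  ... | yes a<0 | _ = inj₁ (negative-below a<0)
  ... | no a≮0 | no 0≮p =
    let l , 0<l , Ll = L-open y 0<y
    in inj₂ (l , 0<l , Ll ,
             ≤-<-trans (≮⇒≥ 0≮p) (0<a*b (≤-<-trans (≮⇒≥ a≮0) a<b) 0<l))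
  ... | no a≮0 | yes 0<p with <-dense a<b
  ... | m , a<m , m<b with <-dense m<b
  ... | k , m<k , k<b = split (quotient p m 0<m) (quotient p k 0<k)
    where
    0<m : 0ℚ < m
    0<m = ≤-<-trans (≮⇒≥ a≮0) a<m

    0<k : 0ℚ < k
    0<k = <-trans 0<m m<k

    positive-factor : ∀ {q c} → 0ℚ < c → q * c ≡ p → 0ℚ < q
    positive-factor {q} {c} 0<c qc≡p =
      cancelʳ-< c 0<c (subst₂ _<_ (sym (*-zeroˡ c)) (sym qc≡p) 0<p)

    split : (∃ λ u → u * m ≡ p) → (∃ λ l → l * k ≡ p) →
            (∃ λ u → U y u × a * u < p) ⊎ (∃ λ l → 0ℚ < l × L y l × p < b * l)
    split (u , um≡p) (l , lk≡p) with positive-factor 0<m um≡p | positive-factor 0<k lk≡p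
    ... | 0<u | 0<l with located y {l} {u} (cancelʳ-< k 0<k
                           (subst (_< u * k) (trans um≡p (sym lk≡p)) (*-monoʳ-<-pos u {{positive 0<u}} m<k)))
    ...   | inj₁ Ll =
      inj₂ (l , 0<l , Ll , subst (_< b * l) (trans (*-comm k l) lk≡p) (mulʳ-< l 0<l k<b))
    ...   | inj₂ Uu =
      inj₁ (u , Uu , subst (a * u <_) (trans (*-comm m u) um≡p) (mulʳ-< u 0<u a<m))

-- The edge set is a subset of V × V, so loops are allowed.
record Digraph : Set₁ where
  field
    order : ℕ

  V : Set
  V = Fin order

  field
    _⟶_  : Rel V 0ℓ
    _⟶?_ : Decidable _⟶_

open Digraph

size-nonZero : ∀ {n} {S : Subset n} → Nonempty S → ℕ.NonZero ∣ S ∣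
size-nonZero (_ , x∈S) = ℕ.>-nonZero (ℕ.≤-<-trans ℕ.z≤n (x∈p⇒∣p-x∣<∣p∣ x∈S))

module _ (G : Digraph) where

  VertexSet : Set
  VertexSet = Subset (order G)

  -- Without an edge the maximum density is 0, and the bound by a number ≥ 1 fails.
  HasEdge : Set
  HasEdge = ∃ λ u → ∃ λ v → _⟶_ G u v

  edgesBetween : VertexSet → VertexSet → List (V G × V G)
  edgesBetween S T =
    filter (λ (u , v) → (u ∈? S) ×-dec (v ∈? T) ×-dec _⟶?_ G u v)
           (cartesianProduct (allFin (order G)) (allFin (order G)))

  density : (S T : VertexSet) → Nonempty S → Nonempty T → ℝ
  density S T S≠∅ T≠∅ =
    divᴿ (natℚ ∣E∣) (0≤natℚ ∣E∣) (√ fromℕ (∣ S ∣ ℕ.* ∣ T ∣))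
         (√-positive (fromℕ (∣ S ∣ ℕ.* ∣ T ∣)) (0<natℚ (∣ S ∣ ℕ.* ∣ T ∣)))
    where
    ∣E∣ = length (edgesBetween S T)
    instance
      _ = size-nonZero S≠∅
      _ = size-nonZero T≠∅
      _ = ℕ.m*n≢0 ∣ S ∣ ∣ T ∣

subsets : ∀ n → List (Subset n)
subsets zero    = Vec.[] ∷ []
subsets (suc n) = map (inside Vec.∷_) (subsets n) ++ map (outside Vec.∷_) (subsets n)

withNonempty : ∀ {n} → Subset n → Maybe (Σ (Subset n) Nonempty)
withNonempty S with nonempty? S
... | yes S≠∅ = just (S , S≠∅)
... | no  _   = nothing

nonemptySubsets : ∀ n → List (Σ (Subset n) Nonempty)
nonemptySubsets n = mapMaybe withNonempty (subsets n)

-- Starting the fold at 0 does not change the maximum, as densities are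
-- nonnegative; it matters only for the graph without vertices.
maxDensity : Digraph → ℝ
maxDensity G = foldr _⊔ᴿ_ 0ᴿ (map (λ ((S , S≠∅) , (T , T≠∅)) → density G S T S≠∅ T≠∅)
                                  (cartesianProduct (nonemptySubsets n) (nonemptySubsets n)))
  where n = order G

ratio : ∀ {n} (S T : Subset n) → Nonempty T → ℝ
ratio S T T≠∅ = fromℚ (ℤ.+ ∣ S ∣ / ∣ T ∣)
  where instance _ = size-nonZero T≠∅

{-# OPTIONS --safe #-}

-- Put e = |E(S,T)|, which is positive because ρ⋆ > 0. The set S′ of tails of the
-- edges in E(S,T) has at most e elements and still carries all these edges, so
-- maximality of e / √(|S||T|) forces |S| ≤ |S′| ≤ e; symmetrically |T| ≤ e.
-- Hence ρ⋆ = e / √(|S||T|) is at least |S| / √(|S||T|) = √(|S|/|T|), and likewise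
-- at least √(|T|/|S|).
module Submission where

open import Defs
open import Data.Fin.Base using (Fin)
open import Data.Fin.Subset using (Nonempty; Subset; inside; outside; ∣_∣; _∈_; _∪_; ⋃; ⁅_⁆)
open import Data.Fin.Subset.Properties
  using (_∈?_; nonempty?; x∈⁅x⁆; ∣⊥∣≡0; ∣⁅x⁆∣≡1; x∈p∪q⁺)
import Data.Integer.Base as ℤ
import Data.Integer.Properties as ℤ
open import Data.List.Base
  using (List; []; _∷_; map; mapMaybe; filter; foldr; length; allFin; cartesianProduct)
open import Data.List.Membership.Propositional using () renaming (_∈_ to _∈ˡ_)
open import Data.List.Membership.Propositional.Properties
  using (∈-++⁺ˡ; ∈-++⁺ʳ; ∈-map⁺; ∈-filter⁺; ∈-cartesianProduct⁺; ∈-allFin)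
open import Data.List.Properties using (length-map)
open import Data.List.Relation.Binary.Sublist.Propositional using (⊆-refl)
open import Data.List.Relation.Binary.Sublist.Propositional.Properties
  using (filter⁺; length-mono-≤)
open import Data.List.Relation.Unary.Any using (here; there)
open import Data.Maybe.Base using (Maybe; just; nothing)
open import Data.Nat.Base as ℕ using (ℕ; zero; suc)
import Data.Nat.Properties as ℕ
open import Data.Nat.Solver using (module +-*-Solver)
open import Data.Product.Base using (∃; _×_; _,_; proj₁; proj₂)
open import Data.Rational.Base hiding (∣_∣)
open import Data.Rational.Properties
import Data.Rational.Unnormalised.Base as ℚᵘ
import Data.Rational.Unnormalised.Properties as ℚᵘ
open import Data.Rational.Solver using () renaming (module +-*-Solver to ℚ-Solver)
open import Data.Sum.Base using (inj₁; inj₂)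
open import Data.Vec.Base as Vec using ()
open import Level using (0ℓ)
open import Relation.Binary.PropositionalEquality
open import Relation.Nullary using (Dec; yes; no; contradiction)
open import Relation.Nullary.Decidable using (_×-dec_)
open import Relation.Unary using (Pred; Decidable)

open ℝ
open Digraph

-- Fractions of natural numbers: order and products.

fromℚᵘ-mono-≤ : ∀ {p q} → p ℚᵘ.≤ q → fromℚᵘ p ≤ fromℚᵘ q
fromℚᵘ-mono-≤ {p} {q} p≤q = toℚᵘ-cancel-≤
  (ℚᵘ.≤-respˡ-≃ (ℚᵘ.≃-sym (toℚᵘ-fromℚᵘ p)) (ℚᵘ.≤-respʳ-≃ (ℚᵘ.≃-sym (toℚᵘ-fromℚᵘ q)) p≤q))

fromℚᵘ-mono-< : ∀ {p q} → p ℚᵘ.< q → fromℚᵘ p < fromℚᵘ q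
fromℚᵘ-mono-< {p} {q} p<q = toℚᵘ-cancel-<
  (ℚᵘ.<-respˡ-≃ (ℚᵘ.≃-sym (toℚᵘ-fromℚᵘ p)) (ℚᵘ.<-respʳ-≃ (ℚᵘ.≃-sym (toℚᵘ-fromℚᵘ q)) p<q))

fromℚᵘ-homo-* : ∀ p q → fromℚᵘ (p ℚᵘ.* q) ≡ fromℚᵘ p * fromℚᵘ q
fromℚᵘ-homo-* p q = toℚᵘ-injective (ℚᵘ.≃-trans (toℚᵘ-fromℚᵘ (p ℚᵘ.* q))
  (ℚᵘ.≃-sym (ℚᵘ.≃-trans (toℚᵘ-homo-* (fromℚᵘ p) (fromℚᵘ q))
    (ℚᵘ.*-cong (toℚᵘ-fromℚᵘ p) (toℚᵘ-fromℚᵘ q)))))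

-- `_/_` reduces to lowest terms. Once the denominators are matched as successors, both sides are
-- `fromℚᵘ` of unreduced fractions, whose order is cross-multiplication by definition.
/-mono-< : ∀ a b c d .{{_ : ℕ.NonZero b}} .{{_ : ℕ.NonZero d}} →
           a ℕ.* d ℕ.< c ℕ.* b → ℤ.+ a / b < ℤ.+ c / d
/-mono-< a (suc b-1) c (suc d-1) ad<cb =
  fromℚᵘ-mono-< {ℚᵘ.mkℚᵘ (ℤ.+ a) b-1} {ℚᵘ.mkℚᵘ (ℤ.+ c) d-1}
    (ℚᵘ.*<* (subst₂ ℤ._<_ (ℤ.pos-* a _) (ℤ.pos-* c _) (ℤ.+<+ ad<cb)))

/-mono-≤ : ∀ a b c d .{{_ : ℕ.NonZero b}} .{{_ : ℕ.NonZero d}} →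
           a ℕ.* d ℕ.≤ c ℕ.* b → ℤ.+ a / b ≤ ℤ.+ c / d
/-mono-≤ a (suc b-1) c (suc d-1) ad≤cb =
  fromℚᵘ-mono-≤ {ℚᵘ.mkℚᵘ (ℤ.+ a) b-1} {ℚᵘ.mkℚᵘ (ℤ.+ c) d-1}
    (ℚᵘ.*≤* (subst₂ ℤ._≤_ (ℤ.pos-* a _) (ℤ.pos-* c _) (ℤ.+≤+ ad≤cb)))

/-*-/ : ∀ a b c d .{{_ : ℕ.NonZero b}} .{{_ : ℕ.NonZero d}} .{{_ : ℕ.NonZero (b ℕ.* d)}} →
        (ℤ.+ a / b) * (ℤ.+ c / d) ≡ ℤ.+ (a ℕ.* c) / (b ℕ.* d)
/-*-/ a (suc b-1) c (suc d-1) =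
  trans (sym (fromℚᵘ-homo-* (ℚᵘ.mkℚᵘ (ℤ.+ a) b-1) (ℚᵘ.mkℚᵘ (ℤ.+ c) d-1)))
        (cong (λ z → z / (suc b-1 ℕ.* suc d-1)) (sym (ℤ.pos-* a c)))

natℚ-mono-≤ : ∀ {m n} → m ℕ.≤ n → natℚ m ≤ natℚ n
natℚ-mono-≤ {m} {n} m≤n = /-mono-≤ m 1 n 1 (ℕ.*-monoˡ-≤ 1 m≤n)

natℚ-cancel-< : ∀ {m n} → natℚ m < natℚ n → m ℕ.< n
natℚ-cancel-< m<n = ℕ.≰⇒> λ n≤m → <-irrefl refl (<-≤-trans m<n (natℚ-mono-≤ n≤m))

natℚ-homo-* : ∀ m n → natℚ (m ℕ.* n) ≡ natℚ m * natℚ n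
natℚ-homo-* m n = sym (/-*-/ m 1 n 1)

/-*-natℚ : ∀ m n .{{_ : ℕ.NonZero n}} → (ℤ.+ m / n) * natℚ n ≡ natℚ m
/-*-natℚ m n = trans (/-*-/ m n n 1) (≤-antisym
    (/-mono-≤ (m ℕ.* n) (n ℕ.* 1) m 1 (ℕ.≤-reflexive (ℕ.*-assoc m n 1)))
    (/-mono-≤ m 1 (m ℕ.* n) (n ℕ.* 1) (ℕ.≤-reflexive (sym (ℕ.*-assoc m n 1)))))
  where instance _ = ℕ.m*n≢0 n 1

-- Rational squares between two natural numbers.

-- Passing from `m` to `suc m` raises the root by at most one: `m < (k + 1)²` already gives
-- `suc m ≤ (k + 1)² < (k + 2)²`.
integer-sqrt : ∀ m → ∃ λ k → k ℕ.* k ℕ.≤ m × m ℕ.< suc k ℕ.* suc k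
integer-sqrt zero = 0 , ℕ.z≤n , ℕ.s≤s ℕ.z≤n
integer-sqrt (suc m) with integer-sqrt m
... | k , kk≤m , m<k′k′ with suc k ℕ.* suc k ℕ.≤? suc m
...   | no  k′k′≰m′ = k , ℕ.m≤n⇒m≤1+n kk≤m , ℕ.≰⇒> k′k′≰m′
...   | yes k′k′≤m′ = suc k , k′k′≤m′ ,
  ℕ.≤-<-trans m<k′k′ (ℕ.*-mono-< (ℕ.n<1+n (suc k)) (ℕ.n<1+n (suc k)))

-- On the grid of mesh 1/N around √m, consecutive squares differ by less than
-- 1 as soon as N ≥ 2m + 2.
square-between : ∀ {m n} → m ℕ.< n → ∃ λ w → 0ℚ < w × natℚ m < w * w × w * w < natℚ n
square-between {m} {n} m<n with integer-sqrt (m ℕ.* ((2 ℕ.* m ℕ.+ 2) ℕ.* (2 ℕ.* m ℕ.+ 2)))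
... | k , kk≤mNN , mNN<k′k′ = w , 0<w , m<ww , ww<n
  where
  N = 2 ℕ.* m ℕ.+ 2

  instance
    N≢0 : ℕ.NonZero N
    N≢0 = ℕ.>-nonZero (ℕ.<-≤-trans (ℕ.s≤s ℕ.z≤n) (ℕ.m≤n+m 2 (2 ℕ.* m)))

    NN≢0 : ℕ.NonZero (N ℕ.* N)
    NN≢0 = ℕ.m*n≢0 N N

  -- As `k` is the integer part of `N√m`, this is the first grid point strictly to the right of
  -- `√m`.
  w = ℤ.+ suc k / N

  0<w : 0ℚ < w
  0<w = positive⁻¹ w {{normalize-pos (suc k) N}}

  ww≡ : w * w ≡ ℤ.+ (suc k ℕ.* suc k) / (N ℕ.* N)
  ww≡ = /-*-/ (suc k) N (suc k) N

  m≤mm : ∀ m → m ℕ.≤ m ℕ.* m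
  m≤mm zero      = ℕ.z≤n
  m≤mm m@(suc _) = ℕ.m≤m*n m m

  -- Otherwise `(mN)² < k² ≤ mN² ≤ (mN)²`, the last inequality because `m ≤ m²` for natural numbers.
  k≤mN : k ℕ.≤ m ℕ.* N
  k≤mN = ℕ.≮⇒≥ λ mN<k → ℕ.<⇒≱ (ℕ.*-mono-< mN<k mN<k) (begin
    k ℕ.* k                   ≤⟨ kk≤mNN ⟩
    m ℕ.* (N ℕ.* N)           ≤⟨ ℕ.*-monoˡ-≤ (N ℕ.* N) (m≤mm m) ⟩
    m ℕ.* m ℕ.* (N ℕ.* N)
      ≡⟨ solve 2 (λ m N → m :* m :* (N :* N) := m :* N :* (m :* N)) refl m N ⟩
    m ℕ.* N ℕ.* (m ℕ.* N)     ∎)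
    where
    open ℕ.≤-Reasoning
    open +-*-Solver

  -- The increment `2k + 1` is at most `2mN + 1 < 2mN + 2N`, and `N = 2m + 2` makes this last sum
  -- exactly `N²`.
  k′k′<nNN : suc k ℕ.* suc k ℕ.< n ℕ.* (N ℕ.* N)
  k′k′<nNN = begin-strict
    suc k ℕ.* suc k
      ≡⟨ solve 1 (λ k → (con 1 :+ k) :* (con 1 :+ k) := k :* k :+ (con 2 :* k :+ con 1)) refl k ⟩
    k ℕ.* k ℕ.+ (2 ℕ.* k ℕ.+ 1)
      ≤⟨ ℕ.+-mono-≤ kk≤mNN (ℕ.+-monoˡ-≤ 1 (ℕ.*-monoʳ-≤ 2 k≤mN)) ⟩
    m ℕ.* (N ℕ.* N) ℕ.+ (2 ℕ.* (m ℕ.* N) ℕ.+ 1)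
      <⟨ ℕ.+-monoʳ-< (m ℕ.* (N ℕ.* N)) (ℕ.+-monoʳ-< (2 ℕ.* (m ℕ.* N))
           (ℕ.<-≤-trans (ℕ.s≤s (ℕ.s≤s ℕ.z≤n)) (ℕ.*-monoʳ-≤ 2 (ℕ.>-nonZero⁻¹ N)))) ⟩
    m ℕ.* (N ℕ.* N) ℕ.+ (2 ℕ.* (m ℕ.* N) ℕ.+ 2 ℕ.* N)
      ≡⟨ solve 1 (λ m → let N = con 2 :* m :+ con 2 in
           m :* (N :* N) :+ (con 2 :* (m :* N) :+ con 2 :* N) := (con 1 :+ m) :* (N :* N)) refl m ⟩
    suc m ℕ.* (N ℕ.* N)
      ≤⟨ ℕ.*-monoˡ-≤ (N ℕ.* N) m<n ⟩
    n ℕ.* (N ℕ.* N) ∎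
    where
    open ℕ.≤-Reasoning
    open +-*-Solver

  m<ww : natℚ m < w * w
  m<ww = subst (natℚ m <_) (sym ww≡)
    (/-mono-< m 1 (suc k ℕ.* suc k) (N ℕ.* N)
      (subst (m ℕ.* (N ℕ.* N) ℕ.<_) (sym (ℕ.*-identityʳ _)) mNN<k′k′))

  ww<n : w * w < natℚ n
  ww<n = subst (_< natℚ n) (sym ww≡)
    (/-mono-< (suc k ℕ.* suc k) (N ℕ.* N) n 1
      (subst (ℕ._< n ℕ.* (N ℕ.* N)) (sym (ℕ.*-identityʳ _)) k′k′<nNN))

-- Quotients by square roots, compared as cuts.

*-interchange : ∀ a b c d → a * b * (c * d) ≡ a * c * (b * d)
*-interchange = solve 4 (λ a b c d → a :* b :* (c :* d) := a :* c :* (b :* d)) refl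
  where open ℚ-Solver

factor-positive : ∀ {q c p} → 0ℚ < c → 0ℚ < p → q * c ≡ p → 0ℚ < q
factor-positive {q} {c} 0<c 0<p qc≡p =
  cancelʳ-< c 0<c (subst₂ _<_ (sym (*-zeroˡ c)) (sym qc≡p) 0<p)

div-nonpositive-below : ∀ {p r} 0≤p y 0<y → 0ℚ < p → r ≤ 0ℚ → L (divᴿ p 0≤p y 0<y) r
div-nonpositive-below {p} {r} _ y 0<y 0<p r≤0 =
  let u , Uu = U-inhabited y
  in u , Uu , ≤-<-trans (mulʳ-≤ u (<⇒≤ (L<U y 0<y Uu)) r≤0) (subst (_< p) (sym (*-zeroˡ u)) 0<p)

-- With `w = p / r` the hypothesis reads `q < w²`. Lowering `w` slightly to `u` keeps `q < u²` and
-- turns `r * w = p` into a strict inequality.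
square-above : ∀ {p q r} → 0ℚ < r → 0ℚ < p → r * r * q < p * p →
               ∃ λ u → 0ℚ < u × q < u * u × r * u < p
square-above {p} {q} {r} 0<r 0<p rrq<pp =
  let w , wr≡p = quotient p r 0<r
      0<w = factor-positive {w} {r} {p} 0<r 0<p wr≡p
      pp≡wwrr : p * p ≡ w * w * (r * r)
      pp≡wwrr = trans (cong (λ p → p * p) (sym wr≡p)) (*-interchange w r w r)
      qrr<pp : q * (r * r) < p * p
      qrr<pp = subst (_< p * p) (*-comm (r * r) q) rrq<pp
      q<ww : q < w * w
      q<ww = cancelʳ-< {q} {w * w} (r * r) (0<a*b {r} {r} 0<r 0<r)
               (subst (q * (r * r) <_) pp≡wwrr qrr<pp)
      u , u<w , 0<u , q<uu = sq-lower {w} {q} 0<w q<ww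
  in u , 0<u , q<uu , subst₂ _<_ (*-comm u r) wr≡p (mulʳ-< {u} {w} r 0<r u<w)

div-√-below : ∀ {p q r} 0≤p 0<√q → 0ℚ < p → r * r * q < p * p →
              L (divᴿ p 0≤p (√ fromℚ q) 0<√q) r
div-√-below {p} {q} {r} 0≤p 0<√q 0<p rrq<pp = by-sign (0ℚ <? r)
  where
  by-sign : Dec (0ℚ < r) → L (divᴿ p 0≤p (√ fromℚ q) 0<√q) r
  by-sign (no  0≮r) = div-nonpositive-below 0≤p (√ fromℚ q) 0<√q 0<p (≮⇒≥ 0≮r)
  by-sign (yes 0<r) =
    let u , 0<u , q<uu , ru<p = square-above 0<r 0<p rrq<pp in u , (0<u , q<uu) , ru<p

-- A w with m < w² < n would make p / w a lower bound of the left quotient but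
-- an upper bound of the right one.
div-√-cancel : ∀ {p p′ m n} 0≤p 0≤p′ 0<√m 0<√n → 0ℚ < p → p ≤ p′ →
               divᴿ p′ 0≤p′ (√ fromℕ m) 0<√m ≤ᴿ divᴿ p 0≤p (√ fromℕ n) 0<√n → n ℕ.≤ m
div-√-cancel {p} {p′} {m} {n} _ _ _ _ 0<p p≤p′ div≤div = ℕ.≮⇒≥ λ m<n →
  let w , 0<w , m<ww , ww<n = square-between m<n
      r , rw≡p = quotient p w 0<w
      0<r = factor-positive {r} {w} {p} 0<w 0<p rw≡p
      wr≡p : w * r ≡ p
      wr≡p = trans (*-comm w r) rw≡p
      u , u<w , 0<u , m<uu = sq-lower {w} {natℚ m} 0<w m<ww
      ru<p : r * u < p
      ru<p = subst₂ _<_ (*-comm u r) wr≡p (mulʳ-< {u} {w} r 0<r u<w)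
      v , (0<v , n<vv) , rv<p = div≤div {r} (u , (0<u , m<uu) , <-≤-trans ru<p p≤p′)
      v<w : v < w
      v<w = cancelʳ-< {v} {w} r 0<r (subst₂ _<_ (*-comm r v) (sym wr≡p) rv<p)
  in <-asym n<vv (<-trans (sq-mono-< {v} {w} (<⇒≤ 0<v) v<w) ww<n)

-- Multiplying `r² < a / b` by `ab` gives `r²ab < a² ≤ e²`. The product enters through the equation
-- `n ≡ a ℕ.* b` so that one density, with one fixed `n`, can be compared with both `a / b` and
-- `b / a`.
√-ratio-≤-div : ∀ {e a b n} .{{_ : ℕ.NonZero b}} 0≤e 0<√n →
                0 ℕ.< e → 0 ℕ.< a → a ℕ.≤ e → n ≡ a ℕ.* b →
                √ fromℚ (ℤ.+ a / b) ≤ᴿ divᴿ (natℚ e) 0≤e (√ fromℕ n) 0<√n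
√-ratio-≤-div {e} {a} {b} {n} 0≤e 0<√n 0<e 0<a a≤e refl {r} = λ where
    (inj₁ r<0)    → div-nonpositive-below {r = r} 0≤e (√ fromℕ n) 0<√n 0<natℚe (<⇒≤ r<0)
    (inj₂ rr<a/b) → div-√-below {r = r} 0≤e 0<√n 0<natℚe (bound rr<a/b)
  where
  0<natℚe : 0ℚ < natℚ e
  0<natℚe = 0<natℚ e {{ℕ.>-nonZero 0<e}}

  bound : r * r < ℤ.+ a / b → r * r * natℚ (a ℕ.* b) < natℚ e * natℚ e
  bound rr<a/b = begin-strict
    r * r * natℚ (a ℕ.* b)             <⟨ mulʳ-< _ 0<ab rr<a/b ⟩
    (ℤ.+ a / b) * natℚ (a ℕ.* b)       ≡⟨ cong (λ n → (ℤ.+ a / b) * natℚ n) (ℕ.*-comm a b) ⟩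
    (ℤ.+ a / b) * natℚ (b ℕ.* a)       ≡⟨ cong ((ℤ.+ a / b) *_) (natℚ-homo-* b a) ⟩
    (ℤ.+ a / b) * (natℚ b * natℚ a)    ≡⟨ *-assoc (ℤ.+ a / b) (natℚ b) (natℚ a) ⟨
    (ℤ.+ a / b) * natℚ b * natℚ a      ≡⟨ cong (_* natℚ a) (/-*-natℚ a b) ⟩
    natℚ a * natℚ a                    ≡⟨ natℚ-homo-* a a ⟨
    natℚ (a ℕ.* a)                     ≤⟨ natℚ-mono-≤ (ℕ.*-mono-≤ a≤e a≤e) ⟩
    natℚ (e ℕ.* e)                     ≡⟨ natℚ-homo-* e e ⟩
    natℚ e * natℚ e                    ∎
    where
    open ≤-Reasoning
    0<ab : 0ℚ < natℚ (a ℕ.* b)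
    0<ab = 0<natℚ (a ℕ.* b) {{ℕ.m*n≢0 a b {{ℕ.>-nonZero 0<a}}}}

-- Finite sets listed by their elements, and maxima over all nonempty subsets.

∣p∪q∣≤∣p∣+∣q∣ : ∀ {n} (p q : Subset n) → ∣ p ∪ q ∣ ℕ.≤ ∣ p ∣ ℕ.+ ∣ q ∣
∣p∪q∣≤∣p∣+∣q∣ Vec.[] Vec.[] = ℕ.z≤n
∣p∪q∣≤∣p∣+∣q∣ (outside Vec.∷ p) (outside Vec.∷ q) = ∣p∪q∣≤∣p∣+∣q∣ p q
∣p∪q∣≤∣p∣+∣q∣ (outside Vec.∷ p) (inside  Vec.∷ q) =
  subst (suc ∣ p ∪ q ∣ ℕ.≤_) (sym (ℕ.+-suc ∣ p ∣ ∣ q ∣)) (ℕ.s≤s (∣p∪q∣≤∣p∣+∣q∣ p q))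
∣p∪q∣≤∣p∣+∣q∣ (inside  Vec.∷ p) (outside Vec.∷ q) = ℕ.s≤s (∣p∪q∣≤∣p∣+∣q∣ p q)
∣p∪q∣≤∣p∣+∣q∣ (inside  Vec.∷ p) (inside  Vec.∷ q) =
  ℕ.s≤s (ℕ.≤-trans (∣p∪q∣≤∣p∣+∣q∣ p q) (ℕ.+-monoʳ-≤ ∣ p ∣ (ℕ.n≤1+n ∣ q ∣)))

elements : ∀ {n} → List (Fin n) → Subset n
elements xs = ⋃ (map ⁅_⁆ xs)

∈-elements : ∀ {n} {x : Fin n} {xs} → x ∈ˡ xs → x ∈ elements xs
∈-elements {x = x} (here refl) = x∈p∪q⁺ (inj₁ (x∈⁅x⁆ x))
∈-elements (there x∈xs)        = x∈p∪q⁺ (inj₂ (∈-elements x∈xs))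

elements-nonempty : ∀ {n} (xs : List (Fin n)) → 0 ℕ.< length xs → Nonempty (elements xs)
elements-nonempty (x ∷ xs) _ = x , ∈-elements {xs = x ∷ xs} (here refl)

-- Repeated entries collapse, as when several edges share a tail, so equality may fail.
∣elements∣≤length : ∀ {n} (xs : List (Fin n)) → ∣ elements xs ∣ ℕ.≤ length xs
∣elements∣≤length {n} []   = ℕ.≤-reflexive (∣⊥∣≡0 n)
∣elements∣≤length (x ∷ xs) = ℕ.≤-trans (∣p∪q∣≤∣p∣+∣q∣ ⁅ x ⁆ (elements xs))
  (ℕ.+-mono-≤ (ℕ.≤-reflexive (∣⁅x⁆∣≡1 x)) (∣elements∣≤length xs))

∈-mapMaybe⁺ : ∀ {A B : Set} (f : A → Maybe B) {x y xs} → x ∈ˡ xs → f x ≡ just y → y ∈ˡ mapMaybe f xs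
∈-mapMaybe⁺ f {xs = x ∷ xs} (here refl) fx≡y with f x
∈-mapMaybe⁺ f {xs = x ∷ xs} (here refl) refl | just _ = here refl
∈-mapMaybe⁺ f {xs = z ∷ xs} (there x∈xs) fx≡y with f z
... | just _  = there (∈-mapMaybe⁺ f x∈xs fx≡y)
... | nothing = ∈-mapMaybe⁺ f x∈xs fx≡y

∈-subsets : ∀ {n} (S : Subset n) → S ∈ˡ subsets n
∈-subsets Vec.[]             = here refl
∈-subsets (inside  Vec.∷ S) = ∈-++⁺ˡ (∈-map⁺ (inside Vec.∷_) (∈-subsets S))
∈-subsets (outside Vec.∷ S) = ∈-++⁺ʳ _ (∈-map⁺ (outside Vec.∷_) (∈-subsets S))

-- The stored proof is the one found by `nonempty?`; it may name another element than the given one,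
-- hence the existential.
withNonempty-just : ∀ {n} {S : Subset n} → Nonempty S → ∃ λ S≠∅ → withNonempty S ≡ just (S , S≠∅)
withNonempty-just {S = S} S≠∅ with nonempty? S
... | yes S≠∅′ = S≠∅′ , refl
... | no  S≡∅  = contradiction S≠∅ S≡∅

∈-nonemptySubsets : ∀ {n} {S : Subset n} → Nonempty S → ∃ λ S≠∅ → (S , S≠∅) ∈ˡ nonemptySubsets n
∈-nonemptySubsets {S = S} S≠∅ =
  let S≠∅′ , eq = withNonempty-just S≠∅
  in S≠∅′ , ∈-mapMaybe⁺ withNonempty (∈-subsets S) eq

length-filter-mono : ∀ {A : Set} {P Q : Pred A 0ℓ} (P? : Decidable P) (Q? : Decidable Q) →
                     (∀ {x} → P x → Q x) → ∀ xs → length (filter P? xs) ℕ.≤ length (filter Q? xs)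
length-filter-mono P? Q? P⇒Q xs =
  length-mono-≤ (filter⁺ P? Q? (λ where refl → P⇒Q) (⊆-refl {x = xs}))

foldr-⊔ᴿ-upper : ∀ {x z} xs → x ∈ˡ xs → x ≤ᴿ foldr _⊔ᴿ_ z xs
foldr-⊔ᴿ-upper (_ ∷ xs) (here refl)  Lr = inj₁ Lr
foldr-⊔ᴿ-upper (_ ∷ xs) (there x∈xs) Lr = inj₂ (foldr-⊔ᴿ-upper xs x∈xs Lr)

-- Edges between two vertex sets and their endpoints.

module _ (G : Digraph) where

  Edge : VertexSet G → VertexSet G → V G × V G → Set
  Edge S T (u , v) = u ∈ S × v ∈ T × _⟶_ G u v

  edge? : ∀ S T → Decidable (Edge S T)
  edge? S T (u , v) = (u ∈? S) ×-dec (v ∈? T) ×-dec _⟶?_ G u v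

  ∣E∣ : VertexSet G → VertexSet G → ℕ
  ∣E∣ S T = length (edgesBetween G S T)

  ∈-edgesBetween : ∀ {S T e} → Edge S T e → e ∈ˡ edgesBetween G S T
  ∈-edgesBetween {S} {T} {u , v} =
    ∈-filter⁺ (edge? S T) (∈-cartesianProduct⁺ (∈-allFin u) (∈-allFin v))

  ∣E∣-mono : ∀ {S T S′ T′} → (∀ {e} → Edge S T e → Edge S′ T′ e) → ∣E∣ S T ℕ.≤ ∣E∣ S′ T′
  ∣E∣-mono {S} {T} {S′} {T′} E⊆E′ = length-filter-mono (edge? S T) (edge? S′ T′) E⊆E′
    (cartesianProduct (allFin (order G)) (allFin (order G)))

  -- For `proj₁` this is the set of tails of the edges from `S` to `T`, for `proj₂` the set of their
  -- heads.
  image : (V G × V G → V G) → VertexSet G → VertexSet G → VertexSet G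
  image f S T = elements (map f (edgesBetween G S T))

  ∈-image : ∀ f {S T e} → Edge S T e → f e ∈ image f S T
  ∈-image f E = ∈-elements (∈-map⁺ f (∈-edgesBetween E))

  ∣image∣≤ : ∀ f S T → ∣ image f S T ∣ ℕ.≤ ∣E∣ S T
  ∣image∣≤ f S T = subst (∣ image f S T ∣ ℕ.≤_) (length-map f (edgesBetween G S T))
    (∣elements∣≤length (map f (edgesBetween G S T)))

  image-nonempty : ∀ f S T → 0 ℕ.< ∣E∣ S T → Nonempty (image f S T)
  image-nonempty f S T 0<e = elements-nonempty (map f (edgesBetween G S T))
    (subst (0 ℕ.<_) (sym (length-map f (edgesBetween G S T))) 0<e)

  √-sizes-positive : ∀ {S T : VertexSet G} → Nonempty S → Nonempty T →
                     Positiveᴿ (√ fromℕ (∣ S ∣ ℕ.* ∣ T ∣))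
  √-sizes-positive {S} {T} S≠∅ T≠∅ = √-positive (fromℕ (∣ S ∣ ℕ.* ∣ T ∣))
    (0<natℚ (∣ S ∣ ℕ.* ∣ T ∣)
      {{ℕ.m*n≢0 ∣ S ∣ ∣ T ∣ {{size-nonZero S≠∅}} {{size-nonZero T≠∅}}}})

  -- A density does not depend on the proofs of nonemptiness it is given, so those
  -- stored in nonemptySubsets may be exchanged for S≠∅ and T≠∅.
  density≤maxDensity : ∀ S T S≠∅ T≠∅ → density G S T S≠∅ T≠∅ ≤ᴿ maxDensity G
  density≤maxDensity S T S≠∅ T≠∅ =
    foldr-⊔ᴿ-upper _ (∈-map⁺ (λ ((S , S≠∅) , (T , T≠∅)) → density G S T S≠∅ T≠∅)
      (∈-cartesianProduct⁺ (proj₂ (∈-nonemptySubsets S≠∅)) (proj₂ (∈-nonemptySubsets T≠∅))))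

  density-positive : ∀ {S T} S≠∅ T≠∅ → 0 ℕ.< ∣E∣ S T → Positiveᴿ (density G S T S≠∅ T≠∅)
  density-positive {S} {T} S≠∅ T≠∅ 0<e =
    div-nonpositive-below (0≤natℚ (∣E∣ S T)) (√ fromℕ (∣ S ∣ ℕ.* ∣ T ∣))
      (√-sizes-positive S≠∅ T≠∅) (0<natℚ (∣E∣ S T) {{ℕ.>-nonZero 0<e}}) ≤-refl

  -- Sizes of a pair attaining the maximum density.

  module _ {S T : VertexSet G} (S≠∅ : Nonempty S) (T≠∅ : Nonempty T)
           (max : maxDensity G ≤ᴿ density G S T S≠∅ T≠∅) where

    -- The endpoints of an edge, taken as singletons, have positive density, so `0ℚ` lies below the
    -- maximum and hence below the density of `S` and `T`. Unfolding that cut leaves `0 * u < e`.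
    edge-exists : HasEdge G → 0 ℕ.< ∣E∣ S T
    edge-exists (a , b , a⟶b) =
      let a≠∅ = a , x∈⁅x⁆ a
          b≠∅ = b , x∈⁅x⁆ b
          0<e = length-positive (∈-edgesBetween {⁅ a ⁆} {⁅ b ⁆} (x∈⁅x⁆ a , x∈⁅x⁆ b , a⟶b))
          u , _ , 0u<e = max {0ℚ} (density≤maxDensity ⁅ a ⁆ ⁅ b ⁆ a≠∅ b≠∅ {0ℚ}
                           (density-positive a≠∅ b≠∅ 0<e))
      in natℚ-cancel-< (subst (_< natℚ (∣E∣ S T)) (*-zeroˡ u) 0u<e)
      where
      length-positive : ∀ {A : Set} {x : A} {xs} → x ∈ˡ xs → 0 ℕ.< length xs
      length-positive {xs = _ ∷ _} _ = ℕ.s≤s ℕ.z≤n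

    module _ (0<e : 0 ℕ.< ∣E∣ S T) where

      -- The new pair has at least as many edges but no larger density, so its denominator cannot be
      -- smaller.
      supporting-sizes : ∀ {S′ T′} → Nonempty S′ → Nonempty T′ →
        (∀ {e} → Edge S T e → Edge S′ T′ e) → ∣ S ∣ ℕ.* ∣ T ∣ ℕ.≤ ∣ S′ ∣ ℕ.* ∣ T′ ∣
      supporting-sizes {S′} {T′} S′≠∅ T′≠∅ E⊆E′ =
        div-√-cancel {m = ∣ S′ ∣ ℕ.* ∣ T′ ∣} {n = ∣ S ∣ ℕ.* ∣ T ∣}
          (0≤natℚ (∣E∣ S T)) (0≤natℚ (∣E∣ S′ T′))
          (√-sizes-positive S′≠∅ T′≠∅) (√-sizes-positive S≠∅ T≠∅)
          (0<natℚ (∣E∣ S T) {{ℕ.>-nonZero 0<e}}) (natℚ-mono-≤ (∣E∣-mono E⊆E′))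
          (λ {r} Lr → max {r} (density≤maxDensity S′ T′ S′≠∅ T′≠∅ {r} Lr))

      ∣S∣≤∣E∣ : ∣ S ∣ ℕ.≤ ∣E∣ S T
      ∣S∣≤∣E∣ = ℕ.≤-trans
        -- Only `S` is replaced, by the set of tails, so `∣ T ∣` is a common factor of both products
        -- and cancels.
        (ℕ.*-cancelʳ-≤ (∣ S ∣) (∣ image proj₁ S T ∣) (∣ T ∣) {{size-nonZero T≠∅}}
          (supporting-sizes (image-nonempty proj₁ S T 0<e) T≠∅
            (λ E@(_ , v∈T , u⟶v) → ∈-image proj₁ E , v∈T , u⟶v)))
        (∣image∣≤ proj₁ S T)

      ∣T∣≤∣E∣ : ∣ T ∣ ℕ.≤ ∣E∣ S T
      ∣T∣≤∣E∣ = ℕ.≤-trans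
        (ℕ.*-cancelˡ-≤ {∣ T ∣} {∣ image proj₂ S T ∣} ∣ S ∣ {{size-nonZero S≠∅}}
          (supporting-sizes S≠∅ (image-nonempty proj₂ S T 0<e)
            (λ E@(u∈S , _ , u⟶v) → u∈S , ∈-image proj₂ E , u⟶v)))
        (∣image∣≤ proj₂ S T)

lemma3p4 : (G : Digraph) → HasEdge G →
    (S T : VertexSet G) (S≠∅ : Nonempty S) (T≠∅ : Nonempty T) →
    density G S T S≠∅ T≠∅ ≃ᴿ maxDensity G →
    maxDensity G ≥ᴿ ((√ ratio S T T≠∅) ⊔ᴿ (√ ratio T S S≠∅))
lemma3p4 G hasEdge S T S≠∅ T≠∅ (density≤max , max≤density) {r} = λ where
    (inj₁ Lr) → density≤max {r} (√-ratio-≤-div {a = ∣ S ∣} {b = ∣ T ∣} 0≤e 0<√n 0<e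
      (ℕ.>-nonZero⁻¹ ∣ S ∣) (∣S∣≤∣E∣ G S≠∅ T≠∅ max≤density 0<e) refl {r} Lr)
    (inj₂ Lr) → density≤max {r} (√-ratio-≤-div {a = ∣ T ∣} {b = ∣ S ∣} 0≤e 0<√n 0<e
      (ℕ.>-nonZero⁻¹ ∣ T ∣) (∣T∣≤∣E∣ G S≠∅ T≠∅ max≤density 0<e) (ℕ.*-comm ∣ S ∣ ∣ T ∣) {r} Lr)
  where
  instance
    _ = size-nonZero S≠∅
    _ = size-nonZero T≠∅

  0<e : 0 ℕ.< ∣E∣ G S T
  0<e = edge-exists G S≠∅ T≠∅ max≤density hasEdge

  0≤e : 0ℚ ≤ natℚ (∣E∣ G S T)
  0≤e = 0≤natℚ (∣E∣ G S T)

  0<√n : Positiveᴿ (√ fromℕ (∣ S ∣ ℕ.* ∣ T ∣))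
  0<√n = √-sizes-positive G S≠∅ T≠∅
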